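{- Let $G=(V,E)$ be a finite graph and let $\underline{r}^G=(r_v)_{v\in V}\in\mathbb{Z}^{V}$. Let $H$ be an arbitrary $2$-cover of $G$, and let $G\cup G$ denote the disjoint union of two copies of $G$ (itself a $2$-cover of $G$). Let $\underline{r}$ denote the vector induced by $\underline{r}^G$ on $H$ and on $G\cup G$, i.e. each lift $u'$ of a vertex $u\in V$ gets value $r_{u'}=r_u$. Then $$\varepsilon_{\underline{r}}(G\cup G)\geq \varepsilon_{\underline{r}}(H).$$ In other words, for any $\underline{r}\in\mathbb{Z}^{V}$, among all $2$-covers $H$ of $G$ the quantity $\varepsilon_{\underline{r}}(H)$ is maximized by $G\cup G$.
   Context: A $2$-cover of $G$ is a graph with vertex set $V\times\{0,1\}$ obtained by choosing, for every edge $uv\in E$, either the pair of edges $(u,0)(v,0),(u,1)(v,1)$ or the pair $(u,0)(v,1),(u,1)(v,0)$, and having no other edges. For a graph $F$ and a vector $\underline{r}=(r_v)\in\mathbb{Z}^{V(F)}$, $\varepsilon_{\underline{r}}(F)$ denotes the number of orientations of $F$ in which every vertex $v$ has in-degree exactly $r_v$. -}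

module Defs where

open import Data.Fin using (Fin)
import Data.Fin.Properties as Fin
open import Data.Integer using (ℤ; +_)
import Data.Integer.Properties as ℤ
open import Data.List using (List; []; _∷_; _++_; map; filter; length; allFin; cartesianProduct)
open import Data.List.Membership.Propositional using (_∈_)
open import Data.List.Membership.Propositional.Properties using (∈-allFin; ∈-cartesianProduct⁺)
open import Data.List.Relation.Unary.All using (all?; lookup; universal)
open import Data.List.Relation.Unary.Unique.Propositional using (Unique)
import Data.List.Relation.Unary.Unique.Propositional.Properties as Unique
open import Data.Nat using (ℕ)
open import Data.Product using (_×_; _,_; proj₁; proj₂)
open import Data.Product.Properties using (≡-dec)
open import Data.Sum using (_⊎_; inj₁)
open import Function.Bundles using (_⇔_; mk⇔)
open import Relation.Binary.Definitions using (Decidable; DecidableEquality; Symmetric)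
open import Relation.Binary.PropositionalEquality using (_≡_; _≢_; refl; sym)
open import Relation.Nullary using (¬_; Dec)
open import Relation.Nullary.Decidable using (map′; _×-dec_)

record FiniteSet : Set₁ where
  field
    Carrier  : Set
    _≟_      : DecidableEquality Carrier
    elements : List Carrier
    complete : ∀ x → x ∈ elements
    unique   : Unique elements

open FiniteSet using (Carrier)

_×𝟚 : FiniteSet → FiniteSet
V ×𝟚 = record
  { Carrier  = Carrier V × Fin 2
  ; _≟_      = ≡-dec V._≟_ Fin._≟_
  ; elements = cartesianProduct V.elements (allFin 2)
  ; complete = λ (u , i) → ∈-cartesianProduct⁺ (V.complete u) (∈-allFin i)
  ; unique   = Unique.cartesianProduct⁺ V.unique (Unique.allFin⁺ 2)
  }
  where module V = FiniteSet V

record Graph (V : FiniteSet) : Set₁ where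
  field
    Adj     : Carrier V → Carrier V → Set
    adj?    : Decidable Adj
    adj-sym : Symmetric Adj
    irrefl  : ∀ {u} → ¬ Adj u u

open Graph using (Adj)

-- For each edge uv of G the pair of edges of H above it is either
-- (u,0)(v,0), (u,1)(v,1) or (u,0)(v,1), (u,1)(v,0).
record Is2Cover {V : FiniteSet} (G : Graph V) (H : Graph (V ×𝟚)) : Set where
  field
    noOtherEdges : ∀ {u v i j} → Adj H (u , i) (v , j) → Adj G u v
    choice       : ∀ {u v} → Adj G u v →
                   (∀ i j → Adj H (u , i) (v , j) ⇔ i ≡ j) ⊎
                   (∀ i j → Adj H (u , i) (v , j) ⇔ i ≢ j)

-- The disjoint union G ∪ G, the copies being tagged by 0 and 1.
twoCopies : ∀ {V} → Graph V → Graph (V ×𝟚)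
twoCopies G = record
  { Adj     = λ (u , i) (v , j) → Adj G u v × i ≡ j
  ; adj?    = λ (u , i) (v , j) → G.adj? u v ×-dec (i Fin.≟ j)
  ; adj-sym = λ (a , p) → G.adj-sym a , sym p
  ; irrefl  = λ (a , _) → G.irrefl a
  }
  where module G = Graph G

twoCopies-is2Cover : ∀ {V} (G : Graph V) → Is2Cover G (twoCopies G)
twoCopies-is2Cover G = record
  { noOtherEdges = proj₁
  ; choice       = λ a → inj₁ λ i j → mk⇔ proj₂ (a ,_)
  }

lift : ∀ {V} → (Carrier V → ℤ) → Carrier (V ×𝟚) → ℤ
lift r (u , _) = r u

-- On a duplicate-free list, each 2-element subset is listed exactly once.
unorderedPairs : {A : Set} → List A → List (A × A)
unorderedPairs []       = []
unorderedPairs (x ∷ xs) = map (x ,_) xs ++ unorderedPairs xs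

edges : ∀ {V} → Graph V → List (Carrier V × Carrier V)
edges {V} G = filter (λ (u , v) → Graph.adj? G u v) (unorderedPairs (FiniteSet.elements V))

-- All ways of directing every edge of a list. A direction of uv is an arc
-- (tail , head), so an orientation is a list with one arc for each edge.
orientations : {A : Set} → List (A × A) → List (List (A × A))
orientations []             = [] ∷ []
orientations ((u , v) ∷ es) =
  map ((u , v) ∷_) (orientations es) ++ map ((v , u) ∷_) (orientations es)

module _ (V : FiniteSet) where
  open FiniteSet V using (_≟_; elements; complete)

  inDegree : List (Carrier V × Carrier V) → Carrier V → ℕ
  inDegree arcs v = length (filter (λ (_ , head) → head ≟ v) arcs)

  HasInDegrees : (Carrier V → ℤ) → List (Carrier V × Carrier V) → Set
  HasInDegrees r arcs = ∀ v → + inDegree arcs v ≡ r v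

  hasInDegrees? : ∀ r arcs → Dec (HasInDegrees r arcs)
  hasInDegrees? r arcs =
    map′ (λ p v → lookup p (complete v)) (λ p → universal p elements)
         (all? (λ v → + inDegree arcs v ℤ.≟ r v) elements)

ε : ∀ {V} → (Carrier V → ℤ) → Graph V → ℕ
ε {V} r F = length (filter (hasInDegrees? V r) (orientations (edges F)))

{-# OPTIONS --safe #-}

-- Project an orientation of a 2-cover H to G. At an edge of G the two lifts point either in the
-- same or in opposite directions; the former edges contribute the same to every 2-cover, so fix
-- the set S of the latter. Recording the difference of the in-degrees of (u,0) and (u,1), the
-- orientations of the lifts of S correspond to the choices of x : S → {±1} with
-- Σ x_e (δ_u + s_e δ_v) = 0, where s_e = −1 if e = uv is lifted to parallel and s_e = +1 if it is
-- lifted to crossed edges. It remains to see that the number of such x is largest if all s_e = −1.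
--
-- In a balanced x, half of the edge ends at a vertex u carry the sign + and half of them −. Hence,
-- up to the factor deg(u)/2, the number of balanced x is the sum, over all ways to match a given
-- end at u with another end at u, of the numbers of x giving opposite signs to the two. Two matched
-- edges merge into one, which is parallel if both were; induction on the number of edges reduces
-- to loops, which admit two values of x_e if s_e = −1 but none otherwise.
module Submission where

open import Data.Fin using (Fin)
open import Data.Fin.Patterns using (0F; 1F)
open import Data.Integer using (ℤ; +_; 0ℤ; 1ℤ; -1ℤ; _+_; _*_; _-_; -_; _≤_; +≤+; drop‿+≤+; nonNegative)
import Data.Integer.Properties as ℤ
open import Data.Integer.Tactic.RingSolver using (solve-∀)
open import Data.List using (List; []; _∷_; _++_; length; map; filter; concatMap; cartesianProduct; allFin)
import Data.List.Properties as List
open import Data.List.Relation.Binary.Permutation.Propositional using (_↭_; prep; swap; ↭-refl; ↭-reflexive; ↭-trans)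
import Data.List.Relation.Binary.Permutation.Propositional as Perm
import Data.List.Relation.Binary.Permutation.Propositional.Properties as Perm
open import Data.List.Relation.Unary.All using (All; []; _∷_; all?; lookup; universal)
import Data.List.Relation.Unary.All as All
import Data.List.Relation.Unary.All.Properties as All
open import Data.Nat using (suc; z≤n; _≥_)
import Data.Nat.Properties as ℕ
open import Data.Product using (_×_; _,_; proj₁; proj₂; map₂)
open import Data.Sign as Sign using (Sign; opposite)
import Data.Sign.Properties as Sign
open import Data.Sum using (inj₁; inj₂)
open import Function using (_∘_; id; case_of_)
open import Function.Bundles using (_⇔_; mk⇔; Equivalence)
open import Level using (0ℓ)
open import Relation.Binary.PropositionalEquality
open import Relation.Nullary using (Dec; yes; no; contradiction)
open import Relation.Unary using (Pred; Decidable)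
open import Defs

-- Indicators, signs and shifted vectors.

+-interchange : ∀ a b c d → (a + b) + (c + d) ≡ (a + c) + (b + d)
+-interchange = solve-∀

⟦_⟧ : Sign → ℤ
⟦ Sign.+ ⟧ = 1ℤ
⟦ Sign.- ⟧ = -1ℤ

indicator : {P : Set} → Dec P → ℤ
indicator (yes _) = 1ℤ
indicator (no _)  = 0ℤ

indicator-cong : {P Q : Set} (p? : Dec P) (q? : Dec Q) → (P → Q) → (Q → P) → indicator p? ≡ indicator q?
indicator-cong (yes p) (yes q) f g = refl
indicator-cong (yes p) (no ¬q) f g = contradiction (f p) ¬q
indicator-cong (no ¬p) (yes q) f g = contradiction (g q) ¬p
indicator-cong (no ¬p) (no ¬q) f g = refl

indicator-nonneg : {P : Set} (p? : Dec P) → 0ℤ ≤ indicator p?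
indicator-nonneg (yes _) = +≤+ z≤n
indicator-nonneg (no _)  = +≤+ z≤n

indicator-× : {P Q R : Set} (p? : Dec P) (q? : Dec Q) (r? : Dec R) →
              (P → Q × R) → (Q → R → P) → indicator p? ≡ indicator q? * indicator r?
indicator-× (yes p) (yes q) (yes r) f g = refl
indicator-× (yes p) (yes q) (no ¬r) f g = contradiction (proj₂ (f p)) ¬r
indicator-× (yes p) (no ¬q) r?      f g = contradiction (proj₁ (f p)) ¬q
indicator-× (no ¬p) (yes q) (yes r) f g = contradiction (g q r) ¬p
indicator-× (no ¬p) (yes q) (no ¬r) f g = refl
indicator-× (no ¬p) (no ¬q) r?      f g = sym (ℤ.*-zeroˡ (indicator r?))

indicator-mono : ∀ {P : Set} (p? : Dec P) {x y} → (P → x ≤ y) → indicator p? * x ≤ indicator p? * y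
indicator-mono (yes p) {x} {y} x≤y rewrite ℤ.*-identityˡ x | ℤ.*-identityˡ y = x≤y p
indicator-mono (no _)  {x} {y} x≤y rewrite ℤ.*-zeroˡ x | ℤ.*-zeroˡ y = ℤ.≤-refl

⟦opposite⟧ : ∀ s → ⟦ opposite s ⟧ ≡ - ⟦ s ⟧
⟦opposite⟧ Sign.+ = refl
⟦opposite⟧ Sign.- = refl

⟦*⟧ : ∀ s t → ⟦ s Sign.* t ⟧ ≡ ⟦ s ⟧ * ⟦ t ⟧
⟦*⟧ Sign.+ Sign.+ = refl
⟦*⟧ Sign.+ Sign.- = refl
⟦*⟧ Sign.- Sign.+ = refl
⟦*⟧ Sign.- Sign.- = refl

⟦s⟧*⟦s⟧≡1 : ∀ s → ⟦ s ⟧ * ⟦ s ⟧ ≡ 1ℤ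
⟦s⟧*⟦s⟧≡1 Sign.+ = refl
⟦s⟧*⟦s⟧≡1 Sign.- = refl

-- Used for parallel edges: extending a path by one leaves the sign at its moving end unchanged.
opposite[s*-]≡s : ∀ s → opposite (s Sign.* Sign.-) ≡ s
opposite[s*-]≡s Sign.+ = refl
opposite[s*-]≡s Sign.- = refl

≢opposite⇒≡ : ∀ s t → t ≢ opposite s → t ≡ s
≢opposite⇒≡ Sign.+ Sign.+ t≢ = refl
≢opposite⇒≡ Sign.+ Sign.- t≢ = contradiction refl t≢
≢opposite⇒≡ Sign.- Sign.+ t≢ = contradiction refl t≢
≢opposite⇒≡ Sign.- Sign.- t≢ = refl

infixl 6 _⊕_

_⊕_ : {A : Set} → (A → ℤ) → (A → ℤ) → A → ℤ
(f ⊕ g) x = f x + g x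

shift : {A : Set} → Sign → (A → ℤ) → (A → ℤ) → A → ℤ
shift s q w x = q x + ⟦ s ⟧ * w x

shift-cong : {A : Set} (s : Sign) {q q′ w : A → ℤ} → q ≗ q′ → shift s q w ≗ shift s q′ w
shift-cong s {w = w} eq x = cong (_+ ⟦ s ⟧ * w x) (eq x)

shift-comm : {A : Set} (s t : Sign) (q v w : A → ℤ) → shift s (shift t q v) w ≗ shift t (shift s q w) v
shift-comm s t q v w x = lemma (q x) (⟦ t ⟧ * v x) (⟦ s ⟧ * w x)
  where
  lemma : ∀ a b c → a + b + c ≡ a + c + b
  lemma = solve-∀

-- Picking one entry of a list, and finite sums.

picks : {A : Set} → List A → List (A × List A)
picks []       = []
picks (x ∷ xs) = (x , xs) ∷ map (map₂ (x ∷_)) (picks xs)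

picks-length : {A : Set} (xs : List A) → All (λ (_ , ys) → suc (length ys) ≡ length xs) (picks xs)
picks-length []       = []
picks-length (x ∷ xs) = refl ∷ All.map⁺ (All.map (cong suc) (picks-length xs))

sumOver : {A : Set} → (A → ℤ) → List A → ℤ
sumOver f []       = 0ℤ
sumOver f (x ∷ xs) = f x + sumOver f xs

sumOver-map : {A B : Set} (f : B → ℤ) (g : A → B) (xs : List A) →
              sumOver f (map g xs) ≡ sumOver (λ x → f (g x)) xs
sumOver-map f g []       = refl
sumOver-map f g (x ∷ xs) = cong (_+_ (f (g x))) (sumOver-map f g xs)

sumOver-+ : {A : Set} (f g h : A → ℤ) → (∀ x → f x ≡ g x + h x) → (xs : List A) →
            sumOver f xs ≡ sumOver g xs + sumOver h xs
sumOver-+ f g h eq []       = refl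
sumOver-+ f g h eq (x ∷ xs) = trans (cong₂ _+_ (eq x) (sumOver-+ f g h eq xs))
                                    (+-interchange (g x) (h x) (sumOver g xs) (sumOver h xs))

sumOver-mono : {A : Set} {f g : A → ℤ} {xs : List A} →
               All (λ x → f x ≤ g x) xs → sumOver f xs ≤ sumOver g xs
sumOver-mono []       = ℤ.≤-refl
sumOver-mono (p ∷ ps) = ℤ.+-mono-≤ p (sumOver-mono ps)

-- An edge end at u (a and b indicate whether the ends of the edge are at u) carrying the sign τ
-- contributes 1 = 2[τ = −α] + ατ to the degree.
end-count : ∀ α s a b D x (c : Sign → ℤ) → let w = 1ℤ * a + ⟦ s ⟧ * b in
  + 2 * (a * c (opposite α) + b * c (opposite (α Sign.* s))) +
    ((D + ⟦ α ⟧ * (x + 1ℤ * w)) * c Sign.+ + (D + ⟦ α ⟧ * (x + -1ℤ * w)) * c Sign.-) ≡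
  (a + b + D + ⟦ α ⟧ * x) * (c Sign.+ + c Sign.-)
end-count α s a b D x c = trans
  (cong (_+ rest) (trans (pull a b (c (opposite α)) (c (opposite (α Sign.* s))))
    (cong₂ (λ y z → a * y + b * z) (twice α)
      (trans (twice (α Sign.* s))
        (cong (λ t → (c Sign.+ + c Sign.-) - t * (c Sign.+ - c Sign.-)) (⟦*⟧ α s))))))
  (lemma ⟦ α ⟧ ⟦ s ⟧ a b D x (c Sign.+) (c Sign.-))
  where
  rest : ℤ
  rest = (D + ⟦ α ⟧ * (x + 1ℤ * (1ℤ * a + ⟦ s ⟧ * b))) * c Sign.+ +
         (D + ⟦ α ⟧ * (x + -1ℤ * (1ℤ * a + ⟦ s ⟧ * b))) * c Sign.-
  twice : ∀ t → + 2 * c (opposite t) ≡ (c Sign.+ + c Sign.-) - ⟦ t ⟧ * (c Sign.+ - c Sign.-)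
  twice Sign.+ = twice₊ (c Sign.+) (c Sign.-)
    where twice₊ : ∀ y z → + 2 * z ≡ (y + z) - 1ℤ * (y - z)
          twice₊ = solve-∀
  twice Sign.- = twice₋ (c Sign.+) (c Sign.-)
    where twice₋ : ∀ y z → + 2 * y ≡ (y + z) - -1ℤ * (y - z)
          twice₋ = solve-∀
  pull : ∀ a b y z → + 2 * (a * y + b * z) ≡ a * (+ 2 * y) + b * (+ 2 * z)
  pull = solve-∀
  lemma : ∀ α s a b D x y z →
    a * ((y + z) - α * (y - z)) + b * ((y + z) - α * s * (y - z)) +
    ((D + α * (x + 1ℤ * (1ℤ * a + s * b))) * y + (D + α * (x + -1ℤ * (1ℤ * a + s * b))) * z) ≡
    (a + b + D + α * x) * (y + z)
  lemma = solve-∀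

-- Balanced sign assignments.

module Counting (V : FiniteSet) where
  open FiniteSet V

  isZero? : (q : Carrier → ℤ) → Dec (All (λ v → q v ≡ 0ℤ) elements)
  isZero? q = all? (λ v → q v ℤ.≟ 0ℤ) elements

  isZero : (Carrier → ℤ) → ℤ
  isZero q = indicator (isZero? q)

  isZero-cong : ∀ {q q′} → q ≗ q′ → isZero q ≡ isZero q′
  isZero-cong eq = indicator-cong (isZero? _) (isZero? _)
    (All.map λ {v} e → trans (sym (eq v)) e) (All.map λ {v} e → trans (eq v) e)

  δ : Carrier → Carrier → ℤ
  δ u v = indicator (u ≟ v)

  δ-refl : ∀ u → δ u u ≡ 1ℤ
  δ-refl u with u ≟ u
  ... | yes _  = refl
  ... | no u≢u = contradiction refl u≢u

  δ-≢ : ∀ {u v} → u ≢ v → δ u v ≡ 0ℤ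
  δ-≢ {u} {v} u≢v with u ≟ v
  ... | yes u≡v = contradiction u≡v u≢v
  ... | no _    = refl

  -- The sign is that of the second end relative to the first: - for an edge lifted to parallel
  -- edges, + for crossed ones.
  SignedEdge : Set
  SignedEdge = Carrier × Carrier × Sign

  half : Sign → Carrier → Carrier → ℤ
  half s u x = ⟦ s ⟧ * δ u x

  weight : (Sign → Sign) → SignedEdge → Carrier → ℤ
  weight f (u , v , s) = half Sign.+ u ⊕ half (f s) v

  -- The number of x : S → {±1} with q + Σ x_e · weight f e = 0. The map f relabels the signs,
  -- so that H (f = id) and G ∪ G (f = parallel) share one edge list.
  balanced : (Sign → Sign) → List SignedEdge → (Carrier → ℤ) → ℤ
  balanced f []      q = isZero q
  balanced f (e ∷ S) q = balanced f S (shift Sign.+ q (weight f e)) + balanced f S (shift Sign.- q (weight f e))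

  balanced-cong : ∀ f S {q q′} → q ≗ q′ → balanced f S q ≡ balanced f S q′
  balanced-cong f []      eq = isZero-cong eq
  balanced-cong f (e ∷ S) eq = cong₂ _+_
    (balanced-cong f S (shift-cong Sign.+ eq)) (balanced-cong f S (shift-cong Sign.- eq))

  balanced-nonneg : ∀ f S q → 0ℤ ≤ balanced f S q
  balanced-nonneg f []      q = indicator-nonneg (isZero? q)
  balanced-nonneg f (e ∷ S) q = ℤ.+-mono-≤ (balanced-nonneg f S _) (balanced-nonneg f S _)

  -- Double counting of the edge ends at a vertex.

  degree : Carrier → List SignedEdge → ℤ
  degree u []                = 0ℤ
  degree u ((v , w , _) ∷ S) = δ v u + δ w u + degree u S

  degree-nonneg : ∀ u S → 0ℤ ≤ degree u S
  degree-nonneg u []                = ℤ.≤-refl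
  degree-nonneg u ((v , w , _) ∷ S) =
    ℤ.+-mono-≤ (ℤ.+-mono-≤ (indicator-nonneg (v ≟ u)) (indicator-nonneg (w ≟ u))) (degree-nonneg u S)

  -- For each end of e at u, the choice of x_e for which that end carries the sign opposite to α.
  merge : (Sign → Sign) → Carrier → Sign → (Carrier → ℤ) → SignedEdge × List SignedEdge → ℤ
  merge f u α q (e@(v , w , s) , S) =
    δ v u * balanced f S (shift (opposite α) q (weight f e)) +
    δ w u * balanced f S (shift (opposite (α Sign.* f s)) q (weight f e))

  merges : (Sign → Sign) → Carrier → Sign → (Carrier → ℤ) → List SignedEdge → ℤ
  merges f u α q S = sumOver (merge f u α q) (picks S)

  -- An edge that stays in the list may have its sign chosen before the picked edge, because shifts
  -- commute.
  merge-∷ : ∀ f u α q e (p : SignedEdge × List SignedEdge) →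
            merge f u α q (map₂ (e ∷_) p) ≡
            merge f u α (shift Sign.+ q (weight f e)) p + merge f u α (shift Sign.- q (weight f e)) p
  merge-∷ f u α q e (e′@(v , w , s) , S′) =
    trans (cong₂ (λ a b → δ v u * a + δ w u * b) (branch (opposite α)) (branch (opposite (α Sign.* f s))))
          (rearrange (δ v u) (δ w u) _ _ _ _)
    where
    branch : ∀ t → balanced f (e ∷ S′) (shift t q (weight f e′)) ≡
             balanced f S′ (shift t (shift Sign.+ q (weight f e)) (weight f e′)) +
             balanced f S′ (shift t (shift Sign.- q (weight f e)) (weight f e′))
    branch t = cong₂ _+_ (balanced-cong f S′ (shift-comm Sign.+ t q (weight f e′) (weight f e)))
                         (balanced-cong f S′ (shift-comm Sign.- t q (weight f e′) (weight f e)))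
    rearrange : ∀ a b c d e g → a * (c + d) + b * (e + g) ≡ (a * c + b * e) + (a * d + b * g)
    rearrange = solve-∀

  merges-∷ : ∀ f u α q e S → merges f u α q (e ∷ S) ≡
             merge f u α q (e , S) +
             (merges f u α (shift Sign.+ q (weight f e)) S + merges f u α (shift Sign.- q (weight f e)) S)
  merges-∷ f u α q e S = cong (_+_ (merge f u α q (e , S))) (trans
    (sumOver-map (merge f u α q) (map₂ (e ∷_)) (picks S))
    (sumOver-+ _ _ _ (merge-∷ f u α q e) (picks S)))

  -- In a balanced assignment the signs of the ends at `u` add up to -q(u), so the ends of sign -α
  -- number (deg(u) + α q(u))/2. Each such end accounts for one term on the left; a loop has two
  -- ends.
  2*merges : ∀ f u α S q → + 2 * merges f u α q S ≡ (degree u S + ⟦ α ⟧ * q u) * balanced f S q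
  2*merges f u α [] q with isZero? q
  ... | no _  = sym (ℤ.*-zeroʳ (0ℤ + ⟦ α ⟧ * q u))
  ... | yes z rewrite lookup z (complete u) | ℤ.*-zeroʳ ⟦ α ⟧ = refl
  2*merges f u α (e@(v , w , s) ∷ S) q = begin
    + 2 * merges f u α q (e ∷ S)
      ≡⟨ cong (_*_ (+ 2)) (merges-∷ f u α q e S) ⟩
    + 2 * (merge f u α q (e , S) +
      (merges f u α (shift Sign.+ q (weight f e)) S + merges f u α (shift Sign.- q (weight f e)) S))
      ≡⟨ distrib (merge f u α q (e , S))
           (merges f u α (shift Sign.+ q (weight f e)) S) (merges f u α (shift Sign.- q (weight f e)) S) ⟩
    + 2 * merge f u α q (e , S) +
      (+ 2 * merges f u α (shift Sign.+ q (weight f e)) S + + 2 * merges f u α (shift Sign.- q (weight f e)) S)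
      ≡⟨ cong (_+_ (+ 2 * merge f u α q (e , S)))
           (cong₂ _+_ (2*merges f u α S (shift Sign.+ q (weight f e))) (2*merges f u α S (shift Sign.- q (weight f e)))) ⟩
    + 2 * merge f u α q (e , S) +
      ((degree u S + ⟦ α ⟧ * shift Sign.+ q (weight f e) u) * balanced f S (shift Sign.+ q (weight f e)) +
       (degree u S + ⟦ α ⟧ * shift Sign.- q (weight f e) u) * balanced f S (shift Sign.- q (weight f e)))
      ≡⟨ end-count α (f s) (δ v u) (δ w u) (degree u S) (q u) (λ t → balanced f S (shift t q (weight f e))) ⟩
    (degree u (e ∷ S) + ⟦ α ⟧ * q u) * balanced f (e ∷ S) q ∎
    where
    open ≡-Reasoning
    distrib : ∀ a b c → + 2 * (a + (b + c)) ≡ + 2 * a + (+ 2 * b + + 2 * c)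
    distrib = solve-∀

  -- Comparison with parallel edges, by induction on the number of edges.

  parallel : Sign → Sign
  parallel _ = Sign.-

  -- The pair of signed ends is an edge with its x_e already fixed; in the parallel case a fixed edge
  -- and its negative are equivalent, whence γ is independent of α.
  Dominated : (Sign → Sign) → List SignedEdge → Set
  Dominated f S = ∀ α β γ u a →
    balanced f S (half α u ⊕ half β a) ≤ balanced parallel S (half γ u ⊕ half (opposite γ) a)

  half-cancel : ∀ α u → half α u ⊕ half (opposite α) u ≗ λ _ → 0ℤ
  half-cancel α u x rewrite ⟦opposite⟧ α = lemma ⟦ α ⟧ (δ u x)
    where
    lemma : ∀ a d → a * d + - a * d ≡ 0ℤ
    lemma = solve-∀

  -- Gluing the edge {u, v} to the path ending in u leaves a path ending in v.
  glue-fst : ∀ α β s u v a → shift (opposite α) (half α u ⊕ half β a) (half Sign.+ u ⊕ half s v) ≗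
             half (opposite (α Sign.* s)) v ⊕ half β a
  glue-fst α β s u v a x rewrite ⟦opposite⟧ (α Sign.* s) | ⟦*⟧ α s | ⟦opposite⟧ α =
    lemma ⟦ α ⟧ ⟦ s ⟧ (δ u x) (δ v x) (half β a x)
    where
    lemma : ∀ α s d e b → α * d + b + - α * (1ℤ * d + s * e) ≡ - (α * s) * e + b
    lemma = solve-∀

  -- The end at `u` is now the second one and carries -αs · s, which cancels `half α u` because s² =
  -- 1.
  glue-snd : ∀ α β s u v a → shift (opposite (α Sign.* s)) (half α u ⊕ half β a) (half Sign.+ v ⊕ half s u) ≗
             half (opposite (α Sign.* s)) v ⊕ half β a
  glue-snd α β s u v a x rewrite ⟦opposite⟧ (α Sign.* s) | ⟦*⟧ α s = trans
    (lemma ⟦ α ⟧ ⟦ s ⟧ (δ u x) (δ v x) (half β a x))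
    (trans (cong (λ o → ⟦ α ⟧ * (1ℤ - o) * δ u x + rest) (⟦s⟧*⟦s⟧≡1 s)) (lemma′ ⟦ α ⟧ (δ u x) rest))
    where
    rest : ℤ
    rest = - (⟦ α ⟧ * ⟦ s ⟧) * δ v x + half β a x
    lemma : ∀ α s d e b → α * d + b + - (α * s) * (1ℤ * e + s * d) ≡ α * (1ℤ - s * s) * d + (- (α * s) * e + b)
    lemma = solve-∀
    lemma′ : ∀ α d b → α * (1ℤ - 1ℤ) * d + b ≡ b
    lemma′ = solve-∀

  -- Gluing an edge at `u` leaves a path from its other end to `a` and one edge fewer to sign. For
  -- parallel edges the end signs are again γ and -γ, so `dom` applies whatever sign the glued end
  -- receives under `f`.
  merge-mono : ∀ f α β γ u a e S → Dominated f S →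
    merge f u α (half α u ⊕ half β a) (e , S) ≤ merge parallel u γ (half γ u ⊕ half (opposite γ) a) (e , S)
  merge-mono f α β γ u a (v , w , s) S dom = ℤ.+-mono-≤
    (indicator-mono (v ≟ u) λ { refl → subst₂ _≤_
      (sym (balanced-cong f S (glue-fst α β (f s) u w a)))
      (sym (balanced-cong parallel S (glue-fst γ (opposite γ) Sign.- u w a)))
      (dom′ w) })
    (indicator-mono (w ≟ u) λ { refl → subst₂ _≤_
      (sym (balanced-cong f S (glue-snd α β (f s) u v a)))
      (sym (balanced-cong parallel S (glue-snd γ (opposite γ) Sign.- u v a)))
      (dom′ v) })
    where
    dom′ : ∀ v → balanced f S (half (opposite (α Sign.* f s)) v ⊕ half β a) ≤
                 balanced parallel S (half (opposite (γ Sign.* Sign.-)) v ⊕ half (opposite γ) a)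
    dom′ v = subst
      (λ t → balanced f S (half (opposite (α Sign.* f s)) v ⊕ half β a) ≤
             balanced parallel S (half t v ⊕ half (opposite γ) a))
      (sym (opposite[s*-]≡s γ)) (dom (opposite (α Sign.* f s)) β γ v a)

  merges-mono : ∀ f α β γ u a S → (∀ S′ → suc (length S′) ≡ length S → Dominated f S′) →
    merges f u α (half α u ⊕ half β a) S ≤ merges parallel u γ (half γ u ⊕ half (opposite γ) a) S
  merges-mono f α β γ u a S smaller = sumOver-mono
    (All.map (λ {(e , S′)} len → merge-mono f α β γ u a e S′ (smaller S′ len)) (picks-length S))

  balanced-split : ∀ f v w s S {q} → (∀ x → q x ≡ 0ℤ) → balanced f ((v , w , s) ∷ S) q ≡
    balanced f S (half Sign.+ v ⊕ half (f s) w) + balanced f S (half Sign.- v ⊕ half (opposite (f s)) w)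
  balanced-split f v w s S {q} q≗0 = cong₂ _+_ (balanced-cong f S pos) (balanced-cong f S neg)
    where
    pos : shift Sign.+ q (weight f (v , w , s)) ≗ half Sign.+ v ⊕ half (f s) w
    pos x rewrite q≗0 x = lemma (half Sign.+ v x) (half (f s) w x)
      where lemma : ∀ a b → 0ℤ + 1ℤ * (a + b) ≡ a + b
            lemma = solve-∀
    neg : shift Sign.- q (weight f (v , w , s)) ≗ half Sign.- v ⊕ half (opposite (f s)) w
    neg x rewrite q≗0 x | ⟦opposite⟧ (f s) = lemma (δ v x) ⟦ f s ⟧ (δ w x)
      where lemma : ∀ a s b → 0ℤ + -1ℤ * (1ℤ * a + s * b) ≡ -1ℤ * a + - s * b
            lemma = solve-∀

  -- With no end waiting to be matched, either sign of the first edge starts a new path, to which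
  -- the hypothesis on shorter lists applies.
  balanced-mono-0 : ∀ f S {q q′} → (∀ x → q x ≡ 0ℤ) → (∀ x → q′ x ≡ 0ℤ) →
    (∀ S′ → suc (length S′) ≡ length S → Dominated f S′) → balanced f S q ≤ balanced parallel S q′
  balanced-mono-0 f [] q≗0 q′≗0 smaller = ℤ.≤-reflexive (isZero-cong λ x → trans (q≗0 x) (sym (q′≗0 x)))
  balanced-mono-0 f ((v , w , s) ∷ S) q≗0 q′≗0 smaller = subst₂ _≤_
    (sym (balanced-split f v w s S q≗0)) (sym (balanced-split parallel v w s S q′≗0))
    -- Here γ is the sign chosen for the edge, since a parallel edge has ends of opposite signs.
    (ℤ.+-mono-≤ (smaller S refl Sign.+ (f s) Sign.+ v w)
                (smaller S refl Sign.- (opposite (f s)) Sign.- v w))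

  end-identity : ∀ α β d → ⟦ α ⟧ * (⟦ α ⟧ * 1ℤ + ⟦ β ⟧ * d) ≡ 1ℤ + ⟦ α ⟧ * ⟦ β ⟧ * d
  end-identity α β d = trans (lemma ⟦ α ⟧ ⟦ β ⟧ d) (cong (_+ ⟦ α ⟧ * ⟦ β ⟧ * d) (⟦s⟧*⟦s⟧≡1 α))
    where
    lemma : ∀ a b d → a * (a * 1ℤ + b * d) ≡ a * a + a * b * d
    lemma = solve-∀

  -- If the path ends at two different vertices, only one end lies at `u`, and both factors equal
  -- deg(u) + 1 > 0.
  cancel-≢ : ∀ D α β γ {x y} → 0ℤ ≤ D →
    (D + ⟦ α ⟧ * (⟦ α ⟧ * 1ℤ + ⟦ β ⟧ * 0ℤ)) * x ≤ (D + ⟦ γ ⟧ * (⟦ γ ⟧ * 1ℤ + ⟦ opposite γ ⟧ * 0ℤ)) * y → x ≤ y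
  cancel-≢ (+ n) α β γ {x} {y} 0≤D le
    rewrite end-identity α β 0ℤ | end-identity γ (opposite γ) 0ℤ
          | ℤ.*-zeroʳ (⟦ α ⟧ * ⟦ β ⟧) | ℤ.*-zeroʳ (⟦ γ ⟧ * ⟦ opposite γ ⟧) | ℕ.+-comm n 1
    = ℤ.*-cancelˡ-≤-pos x y (+ suc n) le

  -- If both ends lie at `u` with equal signs, the factor is deg(u) + 2 on the left, but deg(u) on
  -- the parallel side, where the end signs cancel. Enlarging the latter to deg(u) + 2 is harmless
  -- as y ≥ 0, and then the factor can be cancelled.
  cancel-≡ : ∀ D α γ {x y} → 0ℤ ≤ D → 0ℤ ≤ y →
    (D + ⟦ α ⟧ * (⟦ α ⟧ * 1ℤ + ⟦ α ⟧ * 1ℤ)) * x ≤ (D + ⟦ γ ⟧ * (⟦ γ ⟧ * 1ℤ + ⟦ opposite γ ⟧ * 1ℤ)) * y → x ≤ y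
  cancel-≡ (+ n) α γ {x} {y} 0≤D 0≤y le = ℤ.*-cancelˡ-≤-pos x y (+ suc (suc n))
    (ℤ.≤-trans (subst₂ _≤_ (cong (_* x) (left α)) (cong (_* y) (right γ)) le)
               (ℤ.*-monoʳ-≤-nonNeg y {{nonNegative 0≤y}} (+≤+ (ℕ.m≤n+m n 2))))
    where
    left : ∀ α → + n + ⟦ α ⟧ * (⟦ α ⟧ * 1ℤ + ⟦ α ⟧ * 1ℤ) ≡ + suc (suc n)
    left Sign.+ = cong +_ (ℕ.+-comm n 2)
    left Sign.- = cong +_ (ℕ.+-comm n 2)
    right : ∀ γ → + n + ⟦ γ ⟧ * (⟦ γ ⟧ * 1ℤ + ⟦ opposite γ ⟧ * 1ℤ) ≡ + n
    right Sign.+ = ℤ.+-identityʳ (+ n)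
    right Sign.- = ℤ.+-identityʳ (+ n)

  -- The length is an explicit argument because the lists left by `picks` are not structural
  -- sublists.
  dominated : ∀ f n S → length S ≡ n → Dominated f S
  smaller-dominated : ∀ f n S → suc (length S) ≡ n → Dominated f S

  smaller-dominated f (suc n) S len = dominated f n S (ℕ.suc-injective len)

  dominated f n S len α β γ u a = go (u ≟ a) (β Sign.≟ opposite α)
    where
    smaller : ∀ S′ → suc (length S′) ≡ length S → Dominated f S′
    smaller S′ eq = smaller-dominated f n S′ (trans eq len)
    q q′ : Carrier → ℤ
    q  = half α u ⊕ half β a
    q′ = half γ u ⊕ half (opposite γ) a
    -- The values of `δ u u` and `δ a u` are abstracted, so that each case below can replace them by
    -- 0 or 1.
    Scaled : ℤ → ℤ → Set
    Scaled d d′ = (degree u S + ⟦ α ⟧ * (⟦ α ⟧ * d + ⟦ β ⟧ * d′)) * balanced f S q ≤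
                  (degree u S + ⟦ γ ⟧ * (⟦ γ ⟧ * d + ⟦ opposite γ ⟧ * d′)) * balanced parallel S q′
    scaled : Scaled (δ u u) (δ a u)
    scaled = subst₂ _≤_ (2*merges f u α S q) (2*merges parallel u γ S q′)
      (ℤ.*-monoˡ-≤-nonNeg (+ 2) (merges-mono f α β γ u a S smaller))
    go : Dec (u ≡ a) → Dec (β ≡ opposite α) → balanced f S q ≤ balanced parallel S q′
    go (no u≢a)   _          = cancel-≢ (degree u S) α β γ (degree-nonneg u S)
      (subst₂ Scaled (δ-refl u) (δ-≢ λ a≡u → u≢a (sym a≡u)) scaled)
    -- A closed path with opposite end signs contributes nothing. The common factor would be deg(u),
    -- which may be 0 and cannot be cancelled, so a new path is started instead.
    go (yes refl) (yes refl) = balanced-mono-0 f S (half-cancel α u) (half-cancel γ u) smaller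
    go (yes refl) (no β≢-α)  with refl ← ≢opposite⇒≡ α β β≢-α =
      cancel-≡ (degree u S) α γ (degree-nonneg u S) (balanced-nonneg parallel S q′)
        (subst₂ Scaled (δ-refl u) (δ-refl u) scaled)

  balanced-≤ : ∀ f S → balanced f S (λ _ → 0ℤ) ≤ balanced parallel S (λ _ → 0ℤ)
  balanced-≤ f S = balanced-mono-0 f S (λ _ → refl) (λ _ → refl) (smaller-dominated f (length S))

-- Orientations with prescribed in-degrees.

length-filter-∷ : {A : Set} {P : Pred A 0ℓ} (P? : Decidable P) (x : A) (xs : List A) →
                  + length (filter P? (x ∷ xs)) ≡ indicator (P? x) + + length (filter P? xs)
length-filter-∷ P? x xs with P? x
... | yes _ = refl
... | no _  = refl

module Orienting (V : FiniteSet) where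
  open FiniteSet V
  open Counting V

  remove : Carrier → (Carrier → ℤ) → Carrier → ℤ
  remove u t x = t x - δ u x

  remove-cong : ∀ u {t t′} → t ≗ t′ → remove u t ≗ remove u t′
  remove-cong u eq x = cong (_- δ u x) (eq x)

  remove-comm : ∀ u v t → remove u (remove v t) ≗ remove v (remove u t)
  remove-comm u v t x = lemma (t x) (δ u x) (δ v x)
    where
    lemma : ∀ a b c → a - c - b ≡ a - b - c
    lemma = solve-∀

  -- Here `t` holds the in-degrees still required. It may become negative; it then never returns to
  -- zero, so such branches count nothing.
  oriented : List (Carrier × Carrier) → (Carrier → ℤ) → ℤ
  oriented []             t = isZero t
  oriented ((u , v) ∷ es) t = oriented es (remove v t) + oriented es (remove u t)

  oriented-cong : ∀ es {t t′} → t ≗ t′ → oriented es t ≡ oriented es t′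
  oriented-cong []             eq = isZero-cong eq
  oriented-cong ((u , v) ∷ es) eq =
    cong₂ _+_ (oriented-cong es (remove-cong v eq)) (oriented-cong es (remove-cong u eq))

  -- Demands are removed in any order with the same result. This permits regrouping the edges of a
  -- 2-cover by the edges below them.
  oriented-↭ : ∀ {es es′} → es ↭ es′ → ∀ t → oriented es t ≡ oriented es′ t
  oriented-↭ Perm.refl                t = refl
  oriented-↭ (prep (u , v) p)         t = cong₂ _+_ (oriented-↭ p (remove v t)) (oriented-↭ p (remove u t))
  oriented-↭ (Perm.trans p p′)        t = trans (oriented-↭ p t) (oriented-↭ p′ t)
  oriented-↭ {_ ∷ _ ∷ es} {_ ∷ _ ∷ es′} (swap (u , v) (u′ , v′) p) t = trans
    (cong₂ _+_ (cong₂ _+_ (exchange v′ v) (exchange u′ v)) (cong₂ _+_ (exchange v′ u) (exchange u′ u)))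
    (+-interchange (at v v′) (at v u′) (at u v′) (at u u′))
    where
    at : Carrier → Carrier → ℤ
    at a b = oriented es′ (remove a (remove b t))
    exchange : ∀ a b → oriented es (remove a (remove b t)) ≡ at b a
    exchange a b = trans (oriented-↭ p (remove a (remove b t))) (oriented-cong es′ (remove-comm a b t))

  inDegree-∷ : ∀ u h arcs v → + inDegree V ((u , h) ∷ arcs) v ≡ δ h v + + inDegree V arcs v
  inDegree-∷ u h arcs v with h ≟ v
  ... | yes _ = refl
  ... | no _  = refl

  hasInDegrees-∷ : ∀ r u h arcs → HasInDegrees V r ((u , h) ∷ arcs) → HasInDegrees V (remove h r) arcs
  hasInDegrees-∷ r u h arcs p v = trans (lemma (δ h v) (+ inDegree V arcs v))
    (cong (_- δ h v) (trans (sym (inDegree-∷ u h arcs v)) (p v)))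
    where
    lemma : ∀ a b → b ≡ (a + b) - a
    lemma = solve-∀

  hasInDegrees-∷⁻ : ∀ r u h arcs → HasInDegrees V (remove h r) arcs → HasInDegrees V r ((u , h) ∷ arcs)
  hasInDegrees-∷⁻ r u h arcs p v = trans (inDegree-∷ u h arcs v)
    (trans (cong (_+_ (δ h v)) (p v)) (lemma (δ h v) (r v)))
    where
    lemma : ∀ a b → a + (b - a) ≡ b
    lemma = solve-∀

  count : (Carrier → ℤ) → List (List (Carrier × Carrier)) → ℤ
  count r oss = + length (filter (hasInDegrees? V r) oss)

  count-++ : ∀ r xs ys → count r (xs ++ ys) ≡ count r xs + count r ys
  count-++ r xs ys = cong +_ (trans (cong length (List.filter-++ (hasInDegrees? V r) xs ys))
                                    (List.length-++ (filter (hasInDegrees? V r) xs)))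

  count-∷ : ∀ r u h oss → count r (map ((u , h) ∷_) oss) ≡ count (remove h r) oss
  count-∷ r u h []         = refl
  count-∷ r u h (os ∷ oss) = trans
    (length-filter-∷ (hasInDegrees? V r) ((u , h) ∷ os) (map ((u , h) ∷_) oss))
    (trans (cong₂ _+_ (indicator-cong (hasInDegrees? V r ((u , h) ∷ os)) (hasInDegrees? V (remove h r) os)
                        (hasInDegrees-∷ r u h os) (hasInDegrees-∷⁻ r u h os))
                      (count-∷ r u h oss))
           (sym (length-filter-∷ (hasInDegrees? V (remove h r)) os oss)))

  count-[] : ∀ r → count r ([] ∷ []) ≡ isZero r
  count-[] r = trans (length-filter-∷ (hasInDegrees? V r) [] [])
    (trans (ℤ.+-identityʳ _)
           (indicator-cong (hasInDegrees? V r []) (isZero? r)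
             (λ p → universal (λ v → sym (p v)) elements) (λ z v → sym (lookup z (complete v)))))

  count-orientations : ∀ es r → count r (orientations es) ≡ oriented es r
  count-orientations []             r = count-[] r
  count-orientations ((u , v) ∷ es) r = trans
    (count-++ r (map ((u , v) ∷_) (orientations es)) (map ((v , u) ∷_) (orientations es)))
    (cong₂ _+_ (trans (count-∷ r u v (orientations es)) (count-orientations es (remove v r)))
               (trans (count-∷ r v u (orientations es)) (count-orientations es (remove u r))))

-- Orientations of a 2-cover by sums and differences of in-degrees.

module Lifting (V : FiniteSet) where
  open FiniteSet V
  open Counting V
  open Orienting V using (remove; remove-cong; remove-comm)
  private
    module C₂ = Counting (V ×𝟚)
    module O₂ = Orienting (V ×𝟚)

  -- L lists the edges not yet decided and S those whose two lifts point in opposite directions;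
  -- p and q are the sum and the difference of the in-degrees still required at the two lifts of a vertex.
  paired : (Sign → Sign) → List SignedEdge → List SignedEdge → (Carrier → ℤ) → (Carrier → ℤ) → ℤ
  paired f []                  S p q = isZero p * balanced f S q
  paired f (e@(u , v , _) ∷ L) S p q =
    (paired f L S (remove v (remove v p)) q + paired f L S (remove u (remove u p)) q) +
    paired f L (e ∷ S) (remove u (remove v p)) q

  paired-cong : ∀ f L S {p p′ q q′} → p ≗ p′ → q ≗ q′ → paired f L S p q ≡ paired f L S p′ q′
  paired-cong f []                  S eq eq′ = cong₂ _*_ (isZero-cong eq) (balanced-cong f S eq′)
  paired-cong f (e@(u , v , _) ∷ L) S eq eq′ = cong₂ _+_
    (cong₂ _+_ (paired-cong f L S (remove-cong v (remove-cong v eq)) eq′)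
               (paired-cong f L S (remove-cong u (remove-cong u eq)) eq′))
    (paired-cong f L (e ∷ S) (remove-cong u (remove-cong v eq)) eq′)

  -- The sign of an edge of `S` can be chosen before the rest of `L` is decided: it does not affect
  -- `p`, and shifts of `q` commute.
  paired-∷ : ∀ f L e S p q →
    paired f L (e ∷ S) p q ≡
    paired f L S p (shift Sign.+ q (weight f e)) + paired f L S p (shift Sign.- q (weight f e))
  paired-∷ f []                   e S p q =
    ℤ.*-distribˡ-+ (isZero p) (balanced f S (shift Sign.+ q (weight f e))) (balanced f S (shift Sign.- q (weight f e)))
  paired-∷ f (e′@(u , v , _) ∷ L) e S p q = trans
    (cong₂ _+_ (cong₂ _+_ (paired-∷ f L e S pᵥ q) (paired-∷ f L e S pᵤ q)) both)
    (rearrange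
      (paired f L S pᵥ (shift Sign.+ q w)) (paired f L S pᵥ (shift Sign.- q w))
      (paired f L S pᵤ (shift Sign.+ q w)) (paired f L S pᵤ (shift Sign.- q w))
      (paired f L (e′ ∷ S) p′ (shift Sign.+ q w)) (paired f L (e′ ∷ S) p′ (shift Sign.- q w)))
    where
    pᵤ pᵥ : Carrier → ℤ
    pᵤ = remove u (remove u p)
    pᵥ = remove v (remove v p)
    p′ : Carrier → ℤ
    p′ = remove u (remove v p)
    w w′ : Carrier → ℤ
    w  = weight f e
    w′ = weight f e′
    side : ∀ s → paired f L (e ∷ S) p′ (shift s q w′) ≡
           paired f L S p′ (shift s (shift Sign.+ q w) w′) + paired f L S p′ (shift s (shift Sign.- q w) w′)
    side s = trans (paired-∷ f L e S p′ (shift s q w′))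
      (cong₂ _+_ (paired-cong f L S (λ _ → refl) (shift-comm Sign.+ s q w′ w))
                 (paired-cong f L S (λ _ → refl) (shift-comm Sign.- s q w′ w)))
    both : paired f L (e′ ∷ e ∷ S) p′ q ≡
           paired f L (e′ ∷ S) p′ (shift Sign.+ q w) + paired f L (e′ ∷ S) p′ (shift Sign.- q w)
    -- The sign of `e′` is chosen first to bring `e` to the front, and afterwards put back.
    both = trans (paired-∷ f L e′ (e ∷ S) p′ q)
      (trans (cong₂ _+_ (side Sign.+) (side Sign.-))
      (trans (+-interchange (paired f L S p′ (shift Sign.+ (shift Sign.+ q w) w′)) (paired f L S p′ (shift Sign.+ (shift Sign.- q w) w′))
                    (paired f L S p′ (shift Sign.- (shift Sign.+ q w) w′)) (paired f L S p′ (shift Sign.- (shift Sign.- q w) w′)))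
             (sym (cong₂ _+_ (paired-∷ f L e′ S p′ (shift Sign.+ q w)) (paired-∷ f L e′ S p′ (shift Sign.- q w))))))
    rearrange : ∀ a b c d x y → ((a + b) + (c + d)) + (x + y) ≡ ((a + c) + x) + ((b + d) + y)
    rearrange = solve-∀

  -- The branching over `L` does not depend on `f`, so the comparison holds term by term once it
  -- holds for `balanced`.
  paired-≤ : ∀ f L S p → paired f L S p (λ _ → 0ℤ) ≤ paired parallel L S p (λ _ → 0ℤ)
  paired-≤ f []                  S p = indicator-mono (isZero? p) λ _ → balanced-≤ f S
  paired-≤ f (e@(u , v , _) ∷ L) S p =
    ℤ.+-mono-≤ (ℤ.+-mono-≤ (paired-≤ f L S _) (paired-≤ f L S _)) (paired-≤ f L (e ∷ S) _)

  lifts : Carrier → Carrier → Sign → List ((Carrier × Fin 2) × (Carrier × Fin 2))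
  lifts u v Sign.- = ((u , 0F) , (v , 0F)) ∷ ((u , 1F) , (v , 1F)) ∷ []
  lifts u v Sign.+ = ((u , 0F) , (v , 1F)) ∷ ((u , 1F) , (v , 0F)) ∷ []

  expand : (Sign → Sign) → List SignedEdge → List ((Carrier × Fin 2) × (Carrier × Fin 2))
  expand f []                = []
  expand f ((u , v , s) ∷ L) = lifts u v (f s) ++ expand f L

  δ-same : ∀ u x i → C₂.δ (u , i) (x , i) ≡ δ u x
  δ-same u x i = indicator-cong (FiniteSet._≟_ (V ×𝟚) (u , i) (x , i)) (u ≟ x) (cong proj₁) (cong (_, i))

  δ-other : ∀ u x {i j} → i ≢ j → C₂.δ (u , i) (x , j) ≡ 0ℤ
  δ-other u x i≢j = C₂.δ-≢ (i≢j ∘ cong proj₂)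

  total difference : (Carrier × Fin 2 → ℤ) → Carrier → ℤ
  total      t x = t (x , 0F) + t (x , 1F)
  difference t x = t (x , 0F) - t (x , 1F)

  -- An arc entering copy 0 lowers the difference still required; one entering copy 1 raises it.
  side : Fin 2 → Sign
  side 0F = Sign.-
  side 1F = Sign.+

  total-remove : ∀ u i t → total (O₂.remove (u , i) t) ≗ remove u (total t)
  total-remove u 0F t x rewrite δ-same u x 0F | δ-other u x {0F} {1F} (λ ()) = lemma (t (x , 0F)) (t (x , 1F)) (δ u x)
    where lemma : ∀ a b d → a - d + (b - 0ℤ) ≡ a + b - d
          lemma = solve-∀
  total-remove u 1F t x rewrite δ-same u x 1F | δ-other u x {1F} {0F} (λ ()) = lemma (t (x , 0F)) (t (x , 1F)) (δ u x)
    where lemma : ∀ a b d → a - 0ℤ + (b - d) ≡ a + b - d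
          lemma = solve-∀

  difference-remove : ∀ u i t → difference (O₂.remove (u , i) t) ≗ shift (side i) (difference t) (δ u)
  difference-remove u 0F t x rewrite δ-same u x 0F | δ-other u x {0F} {1F} (λ ()) = lemma (t (x , 0F)) (t (x , 1F)) (δ u x)
    where lemma : ∀ a b d → a - d - (b - 0ℤ) ≡ a - b + -1ℤ * d
          lemma = solve-∀
  difference-remove u 1F t x rewrite δ-same u x 1F | δ-other u x {1F} {0F} (λ ()) = lemma (t (x , 0F)) (t (x , 1F)) (δ u x)
    where lemma : ∀ a b d → a - 0ℤ - (b - d) ≡ a - b + 1ℤ * d
          lemma = solve-∀

  total-remove₂ : ∀ u i v j t → total (O₂.remove (u , i) (O₂.remove (v , j) t)) ≗ remove u (remove v (total t))
  total-remove₂ u i v j t x = trans (total-remove u i (O₂.remove (v , j) t) x) (remove-cong u (total-remove v j t) x)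

  difference-remove₂ : ∀ u i v j t → difference (O₂.remove (u , i) (O₂.remove (v , j) t)) ≗
                       shift (side i) (shift (side j) (difference t) (δ v)) (δ u)
  difference-remove₂ u i v j t x =
    trans (difference-remove u i (O₂.remove (v , j) t) x) (shift-cong (side i) {w = δ u} (difference-remove v j t) x)

  -- Sum and difference determine twice each value, and doubling is injective on the integers.
  isZero-×𝟚 : ∀ t → C₂.isZero t ≡ isZero (total t) * isZero (difference t)
  isZero-×𝟚 t = indicator-× (C₂.isZero? t) (isZero? (total t)) (isZero? (difference t)) split join
    where
    split : All (λ v → t v ≡ 0ℤ) (FiniteSet.elements (V ×𝟚)) →
            All (λ v → total t v ≡ 0ℤ) elements × All (λ v → difference t v ≡ 0ℤ) elements
    split z = universal (λ v → cong₂ _+_ (at v 0F) (at v 1F)) elements ,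
              universal (λ v → cong₂ _-_ (at v 0F) (at v 1F)) elements
      where
      at : ∀ v i → t (v , i) ≡ 0ℤ
      at v i = lookup z (FiniteSet.complete (V ×𝟚) (v , i))
    halve : ∀ {i} → + 2 * i ≡ 0ℤ → i ≡ 0ℤ
    halve {i} eq = ℤ.*-cancelˡ-≡ (+ 2) i 0ℤ eq
    sum+diff : ∀ a b → + 2 * a ≡ (a + b) + (a - b)
    sum+diff = solve-∀
    sum-diff : ∀ a b → + 2 * b ≡ (a + b) - (a - b)
    sum-diff = solve-∀
    join : All (λ v → total t v ≡ 0ℤ) elements → All (λ v → difference t v ≡ 0ℤ) elements →
           All (λ v → t v ≡ 0ℤ) (FiniteSet.elements (V ×𝟚))
    join zₜ z₋ = universal at (FiniteSet.elements (V ×𝟚))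
      where
      at : ∀ v → t v ≡ 0ℤ
      at (v , 0F) = halve (trans (sum+diff (t (v , 0F)) (t (v , 1F)))
        (cong₂ _+_ (lookup zₜ (complete v)) (lookup z₋ (complete v))))
      at (v , 1F) = halve (trans (sum-diff (t (v , 0F)) (t (v , 1F)))
        (cong₂ _-_ (lookup zₜ (complete v)) (lookup z₋ (complete v))))

  -- Of the four ways to direct two lifts, two project to a common direction and leave the
  -- difference unchanged; the other two change it by plus and minus the weight of the edge.
  oriented-expand : ∀ f L t → O₂.oriented (expand f L) t ≡ paired f L [] (total t) (difference t)
  oriented-expand f []                t = isZero-×𝟚 t
  oriented-expand f (e@(u , v , s) ∷ L) t = trans (go (f s) refl)
    (cong (_+_ (paired f L [] (remove v (remove v p)) q + paired f L [] (remove u (remove u p)) q))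
          (sym (paired-∷ f L e [] (remove u (remove v p)) q)))
    where
    p q : Carrier → ℤ
    p = total t
    q = difference t
    at : Carrier → Fin 2 → Carrier → Fin 2 → ℤ
    at a i b j = O₂.oriented (expand f L) (O₂.remove (a , i) (O₂.remove (b , j) t))
    at-eq : ∀ a i b j {p′ q′} → remove a (remove b p) ≗ p′ →
            shift (side i) (shift (side j) q (δ b)) (δ a) ≗ q′ → at a i b j ≡ paired f L [] p′ q′
    at-eq a i b j eq eq′ = trans (oriented-expand f L (O₂.remove (a , i) (O₂.remove (b , j) t)))
      (paired-cong f L [] (λ x → trans (total-remove₂ a i b j t x) (eq x))
                          (λ x → trans (difference-remove₂ a i b j t x) (eq′ x)))
    ±cancel : ∀ a b → a + 1ℤ * b + -1ℤ * b ≡ a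
    ±cancel = solve-∀
    ∓cancel : ∀ a b → a + -1ℤ * b + 1ℤ * b ≡ a
    ∓cancel = solve-∀
    -- The outer two of the four branches direct both lifts alike, the inner two oppositely.
    reorder : ∀ a b c d → (a + b) + (c + d) ≡ (a + d) + (b + c)
    reorder = solve-∀
    -- A separate `σ` lets `lifts` compute while the weight still mentions `f s`.
    go : ∀ σ → f s ≡ σ → O₂.oriented (lifts u v σ ++ expand f L) t ≡
         (paired f L [] (remove v (remove v p)) q + paired f L [] (remove u (remove u p)) q) +
         (paired f L [] (remove u (remove v p)) (shift Sign.+ q (weight f e)) +
          paired f L [] (remove u (remove v p)) (shift Sign.- q (weight f e)))
    go Sign.- fs = trans (reorder (at v 1F v 0F) (at u 1F v 0F) (at v 1F u 0F) (at u 1F u 0F))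
      (cong₂ _+_
        (cong₂ _+_ (at-eq v 1F v 0F (λ _ → refl) (λ x → ∓cancel (q x) (δ v x)))
                   (at-eq u 1F u 0F (λ _ → refl) (λ x → ∓cancel (q x) (δ u x))))
        (cong₂ _+_ (at-eq u 1F v 0F (λ _ → refl) plus) (at-eq v 1F u 0F (remove-comm v u p) minus)))
      where
      plus : ∀ x → q x + -1ℤ * δ v x + 1ℤ * δ u x ≡ q x + 1ℤ * (1ℤ * δ u x + ⟦ f s ⟧ * δ v x)
      plus x rewrite fs = lemma (q x) (δ u x) (δ v x)
        where lemma : ∀ q a b → q + -1ℤ * b + 1ℤ * a ≡ q + 1ℤ * (1ℤ * a + -1ℤ * b)
              lemma = solve-∀
      minus : ∀ x → q x + -1ℤ * δ u x + 1ℤ * δ v x ≡ q x + -1ℤ * (1ℤ * δ u x + ⟦ f s ⟧ * δ v x)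
      minus x rewrite fs = lemma (q x) (δ u x) (δ v x)
        where lemma : ∀ q a b → q + -1ℤ * a + 1ℤ * b ≡ q + -1ℤ * (1ℤ * a + -1ℤ * b)
              lemma = solve-∀
    go Sign.+ fs = trans (reorder (at v 0F v 1F) (at u 1F v 1F) (at v 0F u 0F) (at u 1F u 0F))
      (cong₂ _+_
        (cong₂ _+_ (at-eq v 0F v 1F (λ _ → refl) (λ x → ±cancel (q x) (δ v x)))
                   (at-eq u 1F u 0F (λ _ → refl) (λ x → ∓cancel (q x) (δ u x))))
        (cong₂ _+_ (at-eq u 1F v 1F (λ _ → refl) plus) (at-eq v 0F u 0F (remove-comm v u p) minus)))
      where
      plus : ∀ x → q x + 1ℤ * δ v x + 1ℤ * δ u x ≡ q x + 1ℤ * (1ℤ * δ u x + ⟦ f s ⟧ * δ v x)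
      plus x rewrite fs = lemma (q x) (δ u x) (δ v x)
        where lemma : ∀ q a b → q + 1ℤ * b + 1ℤ * a ≡ q + 1ℤ * (1ℤ * a + 1ℤ * b)
              lemma = solve-∀
      minus : ∀ x → q x + -1ℤ * δ u x + -1ℤ * δ v x ≡ q x + -1ℤ * (1ℤ * δ u x + ⟦ f s ⟧ * δ v x)
      minus x rewrite fs = lemma (q x) (δ u x) (δ v x)
        where lemma : ∀ q a b → q + -1ℤ * a + -1ℤ * b ≡ q + -1ℤ * (1ℤ * a + 1ℤ * b)
              lemma = solve-∀

  -- The edge list of a 2-cover.

  quad : Carrier × Carrier → List ((Carrier × Fin 2) × (Carrier × Fin 2))
  quad (u , v) = ((u , 0F) , (v , 0F)) ∷ ((u , 0F) , (v , 1F)) ∷ ((u , 1F) , (v , 0F)) ∷ ((u , 1F) , (v , 1F)) ∷ []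

  rungs : List Carrier → List ((Carrier × Fin 2) × (Carrier × Fin 2))
  rungs = map λ u → (u , 0F) , (u , 1F)

  double : List Carrier → List (Carrier × Fin 2)
  double xs = cartesianProduct xs (allFin 2)

  -- The left side runs through all pairs at copy 0 of `x` before those at copy 1, whereas `quad`
  -- keeps the four pairs above one pair together; each step moves two pairs past the rest of the
  -- first row.
  quads-row : ∀ x ys → map ((x , 0F) ,_) (double ys) ++ map ((x , 1F) ,_) (double ys) ↭ concatMap quad (map (x ,_) ys)
  quads-row x []       = ↭-refl
  quads-row x (y ∷ ys) = prep _ (prep _ (↭-trans
    (Perm.shifts (map ((x , 0F) ,_) (double ys)) (((x , 1F) , (y , 0F)) ∷ ((x , 1F) , (y , 1F)) ∷ []))
    (prep _ (prep _ (quads-row x ys)))))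

  unorderedPairs-double : ∀ xs → unorderedPairs (double xs) ↭ rungs xs ++ concatMap quad (unorderedPairs xs)
  unorderedPairs-double []       = ↭-refl
  unorderedPairs-double (x ∷ xs) = prep _ (begin
    map ((x , 0F) ,_) (double xs) ++ map ((x , 1F) ,_) (double xs) ++ unorderedPairs (double xs)
      ≡⟨ List.++-assoc (map ((x , 0F) ,_) (double xs)) _ _ ⟨
    (map ((x , 0F) ,_) (double xs) ++ map ((x , 1F) ,_) (double xs)) ++ unorderedPairs (double xs)
      ↭⟨ Perm.++⁺ (quads-row x xs) (unorderedPairs-double xs) ⟩
    concatMap quad (map (x ,_) xs) ++ rungs xs ++ concatMap quad (unorderedPairs xs)
      ↭⟨ Perm.shifts (concatMap quad (map (x ,_) xs)) (rungs xs) ⟩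
    rungs xs ++ concatMap quad (map (x ,_) xs) ++ concatMap quad (unorderedPairs xs)
      ≡⟨ cong (rungs xs ++_) (List.concatMap-++ quad (map (x ,_) xs) (unorderedPairs xs)) ⟨
    rungs xs ++ concatMap quad (unorderedPairs (x ∷ xs)) ∎)
    where open Perm.PermutationReasoning

  LiftAdj : Sign → Fin 2 → Fin 2 → Set
  LiftAdj Sign.- i j = i ≡ j
  LiftAdj Sign.+ i j = i ≢ j

  module _ (G : Graph V) (label : ∀ {u v} → Graph.Adj G u v → Sign) where

    -- As `label` may depend on the proof of adjacency, the one returned by `adj?` is used
    -- throughout.
    signedEdges : List (Carrier × Carrier) → List SignedEdge
    signedEdges []             = []
    signedEdges ((u , v) ∷ ps) with Graph.adj? G u v
    ... | yes a = (u , v , label a) ∷ signedEdges ps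
    ... | no _  = signedEdges ps

    module _ (f : Sign → Sign) (H : Graph (V ×𝟚))
             (noOther : ∀ {u v i j} → Graph.Adj H (u , i) (v , j) → Graph.Adj G u v)
             (above : ∀ {u v} (a : Graph.Adj G u v) i j → Graph.Adj H (u , i) (v , j) ⇔ LiftAdj (f (label a)) i j)
             where

      isEdge? : Decidable {A = (Carrier × Fin 2) × (Carrier × Fin 2)} λ (x , y) → Graph.Adj H x y
      isEdge? (x , y) = Graph.adj? H x y

      filter-quad : ∀ {u v} σ → (∀ i j → Graph.Adj H (u , i) (v , j) ⇔ LiftAdj σ i j) →
                    filter isEdge? (quad (u , v)) ≡ lifts u v σ
      filter-quad Sign.- eqv =
        trans (List.filter-accept isEdge? (from (eqv 0F 0F) refl)) (cong (_ ∷_)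
        (trans (List.filter-reject isEdge? λ a → case to (eqv 0F 1F) a of λ ())
        (trans (List.filter-reject isEdge? λ a → case to (eqv 1F 0F) a of λ ())
        (List.filter-accept isEdge? (from (eqv 1F 1F) refl)))))
        where open Equivalence
      filter-quad Sign.+ eqv =
        trans (List.filter-reject isEdge? λ a → to (eqv 0F 0F) a refl)
        (trans (List.filter-accept isEdge? (from (eqv 0F 1F) λ ())) (cong (_ ∷_)
        (trans (List.filter-accept isEdge? (from (eqv 1F 0F) λ ())) (cong (_ ∷_)
        (List.filter-reject isEdge? λ a → to (eqv 1F 1F) a refl)))))
        where open Equivalence

      filter-quads : ∀ ps → filter isEdge? (concatMap quad ps) ≡ expand f (signedEdges ps)
      filter-quads []             = refl
      filter-quads ((u , v) ∷ ps) with Graph.adj? G u v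
      ... | yes a = trans (List.filter-++ isEdge? (quad (u , v)) (concatMap quad ps))
                          (cong₂ _++_ (filter-quad (f (label a)) (above a)) (filter-quads ps))
      ... | no ¬a = trans (List.filter-++ isEdge? (quad (u , v)) (concatMap quad ps))
                          (cong₂ _++_ (List.filter-none isEdge? {xs = quad (u , v)}
                            ((¬a ∘ noOther) ∷ (¬a ∘ noOther) ∷ (¬a ∘ noOther) ∷ (¬a ∘ noOther) ∷ []))
                            (filter-quads ps))

      filter-rungs : ∀ xs → filter isEdge? (rungs xs) ≡ []
      filter-rungs xs = List.filter-none isEdge? (All.map⁺ (universal (λ _ → Graph.irrefl G ∘ noOther) xs))

      edges-↭ : edges H ↭ expand f (signedEdges (unorderedPairs elements))
      edges-↭ = ↭-trans (Perm.filter-↭ isEdge? (unorderedPairs-double elements))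
        (↭-reflexive (trans (List.filter-++ isEdge? (rungs elements) _)
          (cong₂ _++_ (filter-rungs elements) (filter-quads (unorderedPairs elements)))))

      -- Both lifts of a vertex have the same required in-degree, so the sum starts at twice `r` and
      -- the difference at 0.
      ε-paired : ∀ r → + ε (lift {V} r) H ≡
        paired f (signedEdges (unorderedPairs elements)) [] (λ x → r x + r x) (λ _ → 0ℤ)
      ε-paired r = trans (O₂.count-orientations (edges H) (lift {V} r))
        (trans (O₂.oriented-↭ edges-↭ (lift {V} r))
        (trans (oriented-expand f L (lift {V} r))
               (paired-cong f L [] {total (lift {V} r)} (λ _ → refl) (λ x → ℤ.+-inverseʳ (r x)))))
        where
        L : List SignedEdge
        L = signedEdges (unorderedPairs elements)

-- Comparison of an arbitrary 2-cover with two copies.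

theorem1p7 : (V : FiniteSet) (G : Graph V) (r : FiniteSet.Carrier V → ℤ) (H : Graph (V ×𝟚)) →
    Is2Cover G H → ε (lift {V} r) (twoCopies G) ≥ ε (lift {V} r) H
theorem1p7 V G r H cover = drop‿+≤+ (subst₂ _≤_
  (sym (ε-paired G label id H noOtherEdges above r))
  -- The labels read off from `H` serve here too, each overridden by `parallel`, so both counts run
  -- over one list.
  (sym (ε-paired G label parallel (twoCopies G) proj₁ (λ a i j → mk⇔ proj₂ (a ,_)) r))
  (paired-≤ id (signedEdges G label (unorderedPairs elements)) [] (λ x → r x + r x)))
  where
  open FiniteSet V using (elements)
  open Counting V using (parallel)
  open Lifting V
  open Is2Cover cover
  label : ∀ {u v} → Graph.Adj G u v → Sign
  label a with choice a
  ... | inj₁ _ = Sign.-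
  ... | inj₂ _ = Sign.+
  above : ∀ {u v} (a : Graph.Adj G u v) i j → Graph.Adj H (u , i) (v , j) ⇔ LiftAdj (label a) i j
  above a with choice a
  ... | inj₁ eqv = eqv
  ... | inj₂ eqv = eqv
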